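{- For each prime $p$, the function $n\mapsto\mathrm{ord}_p(\overline{F}_n)$ takes both positive and negative values. More precisely: (1) For every prime $p$, $\mathrm{ord}_p(\overline{F}_p)=p-1>0$. (2) $\mathrm{ord}_2(\overline{F}_7)=-1$. For every odd prime $p$, $\mathrm{ord}_p(\overline{F}_{3p-1})=-\frac{p-1}{2}$, and more generally $\mathrm{ord}_p(\overline{F}_n)<0$ for all integers $n$ with $\frac{8}{3}p\le n\le 3p-1$.
   Context: For a positive integer $n$, $\overline{F}_n=\Big(\prod_{1\le h\le k\le n,\ \gcd(h,k)=1}\frac{h}{k}\Big)^{ -1}$ is the reciprocal of the product of all nonzero Farey fractions of order $n$. For a nonzero rational $x$, $\mathrm{ord}_p(x)$ is the exponent of the prime $p$ in $x$ (possibly negative). -}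

module Defs where

open import Data.Integer.Base as ℤ using (ℤ; +_)
open import Data.List.Base using (List; []; _∷_; foldr; map; concatMap; filter; upTo; length)
open import Data.List.Relation.Unary.All using (All; []; _∷_; universal)
open import Data.List.Relation.Unary.All.Properties using (map⁺; concat⁺)
open import Data.Nat.Base as ℕ using (ℕ; suc)
open import Data.Nat.GCD using (gcd)
open import Data.Nat.Primality.Factorisation using (factorise; factors)
import Data.Nat.Properties as ℕ
open import Data.Rational.Base using (ℚ; mkℚ; 1ℚ; _*_; _/_; 1/_; ↥_; ↧ₙ_; NonZero; Positive)
open import Data.Rational.Properties using (normalize-pos; pos*pos⇒pos; pos⇒nonZero; 1/pos⇒pos)

-- The exponent of the prime p in n: its multiplicity in the prime factorisation of n.
ordℕ : (p n : ℕ) .{{_ : ℕ.NonZero n}} → ℕ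
ordℕ p n = length (filter (p ℕ.≟_) (factors (factorise n)))

∣↥∣-nonZero : ∀ x .{{_ : NonZero x}} → ℕ.NonZero ℤ.∣ ↥ x ∣
∣↥∣-nonZero (mkℚ (+ suc _) _ _)   = _
∣↥∣-nonZero (mkℚ ℤ.-[1+ _ ] _ _) = _

-- ↥ x and ↧ₙ x are the numerator and denominator of x in lowest terms.
ord : (p : ℕ) (x : ℚ) .{{_ : NonZero x}} → ℤ
ord p x = + ordℕ p ℤ.∣ ↥ x ∣ {{∣↥∣-nonZero x}} ℤ.- + ordℕ p (↧ₙ x)

-- The fractions h / k with k ≡ suc j, 1 ≤ h ≤ k and gcd h k ≡ 1; here h is suc i.
fareyRow : ℕ → List ℚ
fareyRow j = map (λ i → + suc i / suc j)
                 (filter (λ i → gcd (suc i) (suc j) ℕ.≟ 1) (upTo (suc j)))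

fareyFractions : ℕ → List ℚ
fareyFractions n = concatMap fareyRow (upTo n)

product : List ℚ → ℚ
product = foldr _*_ 1ℚ

fareyProduct : ℕ → ℚ
fareyProduct n = product (fareyFractions n)

fareyFractions-pos : ∀ n → All Positive (fareyFractions n)
fareyFractions-pos n =
  concat⁺ (map⁺ (universal (λ j → map⁺ (universal (λ i → normalize-pos (suc i) (suc j)) _)) (upTo n)))

product-pos : ∀ {xs} → All Positive xs → Positive (product xs)
product-pos []                   = _
product-pos {x ∷ xs} (px ∷ pxs) = pos*pos⇒pos x {{px}} (product xs) {{product-pos pxs}}

fareyProduct-pos : ∀ n → Positive (fareyProduct n)
fareyProduct-pos n = product-pos (fareyFractions-pos n)

F̄ : ℕ → ℚ
F̄ n = (1/ fareyProduct n) {{pos⇒nonZero (fareyProduct n) {{fareyProduct-pos n}}}}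

F̄-nonZero : ∀ n → NonZero (F̄ n)
F̄-nonZero n = pos⇒nonZero (F̄ n) {{1/pos⇒pos (fareyProduct n) {{fareyProduct-pos n}}}}

ord-F̄ : (p n : ℕ) → ℤ
ord-F̄ p n = ord p (F̄ n) {{F̄-nonZero n}}

{-# OPTIONS --safe #-}

-- ord_p is additive on products, so ord_p(F̄_n) is the sum over k ≤ n of the row sums of
-- ord_p(k) − ord_p(h) over 1 ≤ h ≤ k coprime to k.  For an odd prime p all integers below 3p
-- have ord_p at most 1, and the row of k contributes
--   0 if k < p,   p − 1 if k = p or k = 2p,   −1 if p < k < 2p,
--   and for 2p < k < 3p: −1 from h = p and, exactly when k is odd, a further −1 from h = 2p.
-- The rows up to 2p add up to p − 1, from which the pairs of rows beyond 2p subtract 2 + 1 each.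
-- The value at p = 2, n = 7 comes from evaluating the double sum.

module Submission where

open import Defs
open import Data.Bool.Base using (if_then_else_)
open import Data.Integer.Base as ℤ using (ℤ; +_; -_; 0ℤ; 1ℤ; _⊖_)
import Data.Integer.Properties as ℤ
open import Data.Integer.Tactic.RingSolver using (solve-∀)
open import Data.List.Base using (List; []; _∷_; _++_; [_]; map; filter; length; upTo; concatMap)
import Data.List.Properties as List
open import Data.List.Relation.Binary.Permutation.Propositional.Properties using (↭-length; filter-↭)
open import Data.List.Relation.Unary.All as All using (All; []; _∷_)
open import Data.List.Relation.Unary.All.Properties as All using (++⁺)
open import Data.Nat.Base using (ℕ; zero; suc; _+_; _∸_; _*_; _≤_; _<_; _/_; NonZero; z<s; s≤s; s≤s⁻¹)
open import Data.Nat.Coprimality as Coprime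
  using (Coprime; coprime⇒gcd≡1; prime⇒coprime; coprime-divisor)
open import Data.Nat.Divisibility
  using (_∣_; _∤_; divides; ∣-trans; ∣-refl; >⇒∤; ∣m+n∣m⇒∣n; ∣m∣n⇒∣m+n; ∣1⇒≡1; m∣m*n)
open import Data.Nat.DivMod using (m*n/n≡m)
open import Data.Nat.GCD using (gcd; gcd-greatest)
open import Data.Nat.ListAction.Properties using (∈⇒∣product; product-++)
open import Data.Nat.Primality
  using (Prime; prime⇒irreducible; prime[2]; irreducible[2]; ¬prime[0]; ¬prime[1])
open import Data.Nat.Primality.Factorisation
import Data.Nat.Properties as ℕ
import Data.Nat.Tactic.RingSolver as ℕ
open import Data.Product.Base using (_×_; ∃-syntax; _,_; proj₁; proj₂)
open import Data.Rational.Base as ℚ using (ℚ; mkℚ; Positive; 1/_)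
import Data.Rational.Properties as ℚ
open import Data.Rational.Unnormalised.Base as ℚᵘ using (mkℚᵘ; *≡*; *≤*) renaming (_≃_ to _≃ᵘ_)
import Data.Rational.Unnormalised.Properties as ℚᵘ
open import Data.Sum.Base using (_⊎_; inj₁; inj₂)
open import Function.Base using (_∘_)
open import Relation.Binary.PropositionalEquality hiding ([_])
open import Relation.Nullary.Decidable using (does; yes; no; dec-true; dec-false)
open import Relation.Nullary.Negation.Core using (¬_; contradiction)

open PrimeFactorisation using (isFactorisation; factorsPrime)

private
  variable
    d m n : ℕ

-- Exponents of a prime in positive integers.

ordℕ-factors : ∀ p .{{_ : NonZero n}} (f : PrimeFactorisation n) →
               ordℕ p n ≡ length (filter (p ℕ.≟_) (factors f))
-- Factorisations are unique up to permutation, so the count does not depend on the one that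
-- `factorise` returns.
ordℕ-factors {n} p f = ↭-length (filter-↭ (p ℕ.≟_) (factorisationUnique (factorise n) f))

_*ᶠ_ : PrimeFactorisation m → PrimeFactorisation n → PrimeFactorisation (m * n)
f *ᶠ g = record
  { factors         = factors f ++ factors g
  ; isFactorisation = trans (cong₂ _*_ (isFactorisation f) (isFactorisation g))
                            (sym (product-++ (factors f) (factors g)))
  ; factorsPrime    = ++⁺ (factorsPrime f) (factorsPrime g)
  }

ordℕ-* : ∀ p m n .{{_ : NonZero m}} .{{_ : NonZero n}} .{{_ : NonZero (m * n)}} →
         ordℕ p (m * n) ≡ ordℕ p m + ordℕ p n
ordℕ-* p m n = begin
  ordℕ p (m * n)
    ≡⟨ ordℕ-factors p (f *ᶠ g) ⟩
  length (filter P? (factors f ++ factors g))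
    ≡⟨ cong length (List.filter-++ P? (factors f) (factors g)) ⟩
  length (filter P? (factors f) ++ filter P? (factors g))
    ≡⟨ List.length-++ (filter P? (factors f)) ⟩
  ordℕ p m + ordℕ p n ∎
  where
  open ≡-Reasoning
  P? = p ℕ.≟_
  f = factorise m
  g = factorise n

ordℕ-∤ : ∀ {p} .{{_ : NonZero n}} → p ∤ n → ordℕ p n ≡ 0
ordℕ-∤ {n} {p} p∤n = cong length (List.filter-none (p ℕ.≟_)
  (All.tabulate {xs = factors f} λ { q∈ refl →
    p∤n (subst (p ∣_) (sym (isFactorisation f)) (∈⇒∣product q∈)) }))
  where f = factorise n

ordℕ-self : ∀ {p} .{{_ : NonZero p}} → Prime p → ordℕ p p ≡ 1
ordℕ-self {p} pr = trans (ordℕ-factors p (primeFactorisation[p] pr))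
                         (cong length (List.filter-accept (p ℕ.≟_) {xs = []} refl))

-- The `NonZero` instance depends on the argument, so `cong` does not apply directly.
ordℕ-cong : ∀ p .{{_ : NonZero m}} .{{_ : NonZero n}} → m ≡ n → ordℕ p m ≡ ordℕ p n
ordℕ-cong p refl = refl

-- Orders of positive rationals.

ordDiff : (p m n : ℕ) .{{_ : NonZero m}} .{{_ : NonZero n}} → ℤ
ordDiff p m n = + ordℕ p m ℤ.- + ordℕ p n

-- Additivity, applied to the cross-multiplied equation, gives equal differences of exponents. Hence
-- the order can be read off any numerator and denominator, without reduction to lowest terms.
ord-≃ : ∀ p x .{{_ : ℚ.NonZero x}} {a b} → Positive x → ℚ.toℚᵘ x ≃ᵘ mkℚᵘ (+ suc a) b →
        ord p x ≡ ordDiff p (suc a) (suc b)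
ord-≃ p (mkℚ (+ suc m) d _) {a} {b} _ (*≡* eq) = begin
  + u ℤ.- + v                ≡⟨ solve₁ (+ u) (+ v) (+ y) ⟩
  + (u + y) ℤ.- + v ℤ.- + y  ≡⟨ cong (λ z → + z ℤ.- + v ℤ.- + y) add ⟩
  + (x + v) ℤ.- + v ℤ.- + y  ≡⟨ solve₂ (+ x) (+ v) (+ y) ⟩
  + x ℤ.- + y                ∎
  where
  open ≡-Reasoning
  u = ordℕ p (suc m)
  v = ordℕ p (suc d)
  x = ordℕ p (suc a)
  y = ordℕ p (suc b)
  add : u + y ≡ x + v
  add = begin
    u + y                   ≡⟨ ordℕ-* p (suc m) (suc b) ⟨
    ordℕ p (suc m * suc b)  ≡⟨ ordℕ-cong p (ℤ.+-injective eq) ⟩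
    ordℕ p (suc a * suc d)  ≡⟨ ordℕ-* p (suc a) (suc d) ⟩
    x + v                   ∎
  solve₁ : ∀ u v y → u ℤ.- v ≡ u ℤ.+ y ℤ.- v ℤ.- y
  solve₁ = solve-∀
  solve₂ : ∀ x v y → x ℤ.+ v ℤ.- v ℤ.- y ≡ x ℤ.- y
  solve₂ = solve-∀

ord-/ : ∀ p i j .{{_ : ℚ.NonZero (+ suc i ℚ./ suc j)}} →
        ord p (+ suc i ℚ./ suc j) ≡ ordDiff p (suc i) (suc j)
ord-/ p i j = ord-≃ p (+ suc i ℚ./ suc j) (ℚ.normalize-pos (suc i) (suc j))
                (ℚ.toℚᵘ-fromℚᵘ (mkℚᵘ (+ suc i) j))

ord-* : ∀ p x y .{{_ : ℚ.NonZero x}} .{{_ : ℚ.NonZero y}} .{{_ : ℚ.NonZero (x ℚ.* y)}} →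
        Positive x → Positive y → ord p (x ℚ.* y) ≡ ord p x ℤ.+ ord p y
ord-* p x@(mkℚ (+ suc m) d _) y@(mkℚ (+ suc n) e _) px py = begin
  ord p (x ℚ.* y)
    ≡⟨ ord-≃ p (x ℚ.* y) (ℚ.pos*pos⇒pos x y) (ℚ.toℚᵘ-homo-* x y) ⟩
  + ordℕ p (suc m * suc n) ℤ.- + ordℕ p (suc d * suc e)
    ≡⟨ cong₂ (λ u v → + u ℤ.- + v) (ordℕ-* p (suc m) (suc n)) (ordℕ-* p (suc d) (suc e)) ⟩
  (+ a ℤ.+ + b) ℤ.- (+ a′ ℤ.+ + b′)
    ≡⟨ solve₁ (+ a) (+ b) (+ a′) (+ b′) ⟩
  ord p x ℤ.+ ord p y ∎
  where
  open ≡-Reasoning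
  a = ordℕ p (suc m)
  b = ordℕ p (suc n)
  a′ = ordℕ p (suc d)
  b′ = ordℕ p (suc e)
  solve₁ : ∀ a b a′ b′ → (a ℤ.+ b) ℤ.- (a′ ℤ.+ b′) ≡ (a ℤ.- a′) ℤ.+ (b ℤ.- b′)
  solve₁ = solve-∀

ord-1/ : ∀ p x .{{_ : ℚ.NonZero x}} .{{_ : ℚ.NonZero (1/ x)}} → Positive x → ord p (1/ x) ≡ - ord p x
ord-1/ p (mkℚ (+ suc m) d _) _ = solve₁ (+ ordℕ p (suc d)) (+ ordℕ p (suc m))
  where
  solve₁ : ∀ a b → a ℤ.- b ≡ - (b ℤ.- a)
  solve₁ = solve-∀

ord-cong : ∀ p {x y} .{{_ : ℚ.NonZero x}} .{{_ : ℚ.NonZero y}} → x ≡ y → ord p x ≡ ord p y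
ord-cong p refl = refl

-- From products of lists of fractions to the double sum over k and h.

productℚ-++ : ∀ xs ys → product (xs ++ ys) ≡ product xs ℚ.* product ys
productℚ-++ []       ys = sym (ℚ.*-identityˡ (product ys))
productℚ-++ (x ∷ xs) ys = trans (cong (x ℚ.*_) (productℚ-++ xs ys))
                                (sym (ℚ.*-assoc x (product xs) (product ys)))

sumTo : (ℕ → ℤ) → ℕ → ℤ
sumTo f zero    = 0ℤ
sumTo f (suc n) = sumTo f n ℤ.+ f n

-- The sign anticipates the reciprocal in `F̄`. The positivity proof is irrelevant, so values can be
-- transported along equations of lists.
ordΠ⁻¹ : ∀ p xs → .(All Positive xs) → ℤ
ordΠ⁻¹ p xs pos = - ord p (product xs) {{ℚ.pos⇒nonZero (product xs) {{product-pos pos}}}}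

ordΠ⁻¹-cong : ∀ p {xs ys} .(px : All Positive xs) .(py : All Positive ys) →
              xs ≡ ys → ordΠ⁻¹ p xs px ≡ ordΠ⁻¹ p ys py
ordΠ⁻¹-cong p _ _ refl = refl

ordΠ⁻¹-++ : ∀ p {xs ys} (px : All Positive xs) (py : All Positive ys) →
            ordΠ⁻¹ p (xs ++ ys) (++⁺ px py) ≡ ordΠ⁻¹ p xs px ℤ.+ ordΠ⁻¹ p ys py
ordΠ⁻¹-++ p {xs} {ys} px py = begin
  - ord p (product (xs ++ ys)) {{nz++}}
    ≡⟨ cong -_ (ord-cong p {{nz++}} {{nz*}} (productℚ-++ xs ys)) ⟩
  - ord p (X ℚ.* Y) {{nz*}}
    ≡⟨ cong -_ (ord-* p X Y {{nzx}} {{nzy}} {{nz*}} (product-pos px) (product-pos py)) ⟩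
  - (ord p X {{nzx}} ℤ.+ ord p Y {{nzy}})
    ≡⟨ ℤ.neg-distrib-+ (ord p X {{nzx}}) (ord p Y {{nzy}}) ⟩
  - ord p X {{nzx}} ℤ.+ - ord p Y {{nzy}} ∎
  where
  open ≡-Reasoning
  X = product xs
  Y = product ys
  nz++ = ℚ.pos⇒nonZero (product (xs ++ ys)) {{product-pos (++⁺ px py)}}
  nzx  = ℚ.pos⇒nonZero X {{product-pos px}}
  nzy  = ℚ.pos⇒nonZero Y {{product-pos py}}
  nz*  = ℚ.pos⇒nonZero (X ℚ.* Y) {{ℚ.pos*pos⇒pos X {{product-pos px}} Y {{product-pos py}}}}

-- Applied twice: to a single row, which grows by at most one fraction per step, and to the Farey
-- list, which grows by one row per step.
ordΠ⁻¹-telescope : ∀ p (L l : ℕ → List ℚ)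
                   (pos : ∀ n → All Positive (L n)) (pos′ : ∀ n → All Positive (l n)) →
                   L 0 ≡ [] → (∀ n → L (suc n) ≡ L n ++ l n) →
                   ∀ n → ordΠ⁻¹ p (L n) (pos n) ≡ sumTo (λ i → ordΠ⁻¹ p (l i) (pos′ i)) n
ordΠ⁻¹-telescope p L l pos pos′ L0 L+ zero    = ordΠ⁻¹-cong p (pos 0) [] L0
ordΠ⁻¹-telescope p L l pos pos′ L0 L+ (suc n) = begin
  ordΠ⁻¹ p (L (suc n)) (pos (suc n))
    ≡⟨ ordΠ⁻¹-cong p (pos (suc n)) (++⁺ (pos n) (pos′ n)) (L+ n) ⟩
  ordΠ⁻¹ p (L n ++ l n) (++⁺ (pos n) (pos′ n))
    ≡⟨ ordΠ⁻¹-++ p (pos n) (pos′ n) ⟩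
  ordΠ⁻¹ p (L n) (pos n) ℤ.+ ordΠ⁻¹ p (l n) (pos′ n)
    ≡⟨ cong (ℤ._+ ordΠ⁻¹ p (l n) (pos′ n)) (ordΠ⁻¹-telescope p L l pos pos′ L0 L+ n) ⟩
  sumTo (λ i → ordΠ⁻¹ p (l i) (pos′ i)) (suc n) ∎
  where open ≡-Reasoning

sumTo-cong : ∀ {f g : ℕ → ℤ} → (∀ i → f i ≡ g i) → ∀ n → sumTo f n ≡ sumTo g n
sumTo-cong f≗g zero    = refl
sumTo-cong f≗g (suc n) = cong₂ ℤ._+_ (sumTo-cong f≗g n) (f≗g n)

-- As in fareyRow, the indices are shifted: h = suc i and k = suc j.
term : ℕ → ℕ → ℕ → ℤ
term p j i = if does (gcd (suc i) (suc j) ℕ.≟ 1) then ordDiff p (suc j) (suc i) else 0ℤ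

term-coprime : ∀ p j i → gcd (suc i) (suc j) ≡ 1 → term p j i ≡ ordDiff p (suc j) (suc i)
term-coprime p j i eq =
  cong (if_then ordDiff p (suc j) (suc i) else 0ℤ) (dec-true (gcd (suc i) (suc j) ℕ.≟ 1) eq)

term-¬coprime : ∀ p j i → gcd (suc i) (suc j) ≢ 1 → term p j i ≡ 0ℤ
term-¬coprime p j i ne =
  cong (if_then ordDiff p (suc j) (suc i) else 0ℤ) (dec-false (gcd (suc i) (suc j) ℕ.≟ 1) ne)

row : ℕ → ℕ → ℤ
row p j = sumTo (term p j) (suc j)

module _ (p j : ℕ) where

  private
    frac : ℕ → ℚ
    frac i = + suc i ℚ./ suc j

    P? = λ i → gcd (suc i) (suc j) ℕ.≟ 1

    frac-pos : ∀ is → All Positive (map frac is)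
    frac-pos is = All.map⁺ (All.universal (λ i → ℚ.normalize-pos (suc i) (suc j)) is)

    coprimeFracs : List ℕ → List ℚ
    coprimeFracs is = map frac (filter P? is)

    coprimeFracs-pos : ∀ is → All Positive (coprimeFracs is)
    coprimeFracs-pos is = frac-pos (filter P? is)

    ordΠ⁻¹-singleton : ∀ i → ordΠ⁻¹ p (coprimeFracs [ i ]) (coprimeFracs-pos [ i ]) ≡ term p j i
    ordΠ⁻¹-singleton i with P? i
    ... | no ¬c = trans
      (ordΠ⁻¹-cong p (coprimeFracs-pos [ i ]) []
        (cong (map frac) (List.filter-reject P? {x = i} {xs = []} ¬c)))
      (sym (term-¬coprime p j i ¬c))
    ... | yes c = begin
      ordΠ⁻¹ p (coprimeFracs [ i ]) (coprimeFracs-pos [ i ])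
        ≡⟨ ordΠ⁻¹-cong p (coprimeFracs-pos [ i ]) (frac-pos [ i ])
             (cong (map frac) (List.filter-accept P? {x = i} {xs = []} c)) ⟩
      - ord p (frac i ℚ.* ℚ.1ℚ) {{nz*}}
        ≡⟨ cong -_ (ord-cong p {{nz*}} {{nz}} (ℚ.*-identityʳ (frac i))) ⟩
      - ord p (frac i) {{nz}}
        ≡⟨ cong -_ (ord-/ p i j {{nz}}) ⟩
      - ordDiff p (suc i) (suc j)
        ≡⟨ ℤ-lemma (+ ordℕ p (suc i)) (+ ordℕ p (suc j)) ⟩
      ordDiff p (suc j) (suc i)
        ≡⟨ term-coprime p j i c ⟨
      term p j i ∎
      where
      open ≡-Reasoning
      nz = ℚ.pos⇒nonZero (frac i) {{ℚ.normalize-pos (suc i) (suc j)}}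
      nz* = ℚ.pos⇒nonZero (frac i ℚ.* ℚ.1ℚ) {{product-pos (frac-pos [ i ])}}
      ℤ-lemma : ∀ a b → - (a ℤ.- b) ≡ b ℤ.- a
      ℤ-lemma = solve-∀

  ordΠ⁻¹-fareyRow : .(pos : All Positive (fareyRow j)) → ordΠ⁻¹ p (fareyRow j) pos ≡ row p j
  ordΠ⁻¹-fareyRow _ = trans
    (ordΠ⁻¹-telescope p (λ n → coprimeFracs (upTo n)) (λ i → coprimeFracs [ i ])
      (λ n → coprimeFracs-pos (upTo n)) (λ i → coprimeFracs-pos [ i ]) refl step (suc j))
    (sumTo-cong ordΠ⁻¹-singleton (suc j))
    where
    open ≡-Reasoning
    step : ∀ n → coprimeFracs (upTo (suc n)) ≡ coprimeFracs (upTo n) ++ coprimeFracs [ n ]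
    step n = begin
      coprimeFracs (upTo (suc n))
        ≡⟨ cong coprimeFracs (List.upTo-∷ʳ n) ⟨
      coprimeFracs (upTo n ++ [ n ])
        ≡⟨ cong (map frac) (List.filter-++ P? (upTo n) [ n ]) ⟩
      map frac (filter P? (upTo n) ++ filter P? [ n ])
        ≡⟨ List.map-++ frac (filter P? (upTo n)) (filter P? [ n ]) ⟩
      coprimeFracs (upTo n) ++ coprimeFracs [ n ] ∎

ord-F̄≡sum : ∀ p n → ord-F̄ p n ≡ sumTo (row p) n
ord-F̄≡sum p n = begin
  ord-F̄ p n
    ≡⟨ ord-1/ p (fareyProduct n)
         {{ℚ.pos⇒nonZero (fareyProduct n) {{pos}}}} {{F̄-nonZero n}} pos ⟩
  ordΠ⁻¹ p (fareyFractions n) (fareyFractions-pos n)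
    ≡⟨ ordΠ⁻¹-telescope p fareyFractions fareyRow fareyFractions-pos fareyRow-pos refl step n ⟩
  sumTo (λ j → ordΠ⁻¹ p (fareyRow j) (fareyRow-pos j)) n
    ≡⟨ sumTo-cong (λ j → ordΠ⁻¹-fareyRow p j (fareyRow-pos j)) n ⟩
  sumTo (row p) n ∎
  where
  open ≡-Reasoning
  pos = fareyProduct-pos n
  step : ∀ n → fareyFractions (suc n) ≡ fareyFractions n ++ fareyRow n
  step n = begin
    concatMap fareyRow (upTo (suc n))       ≡⟨ cong (concatMap fareyRow) (List.upTo-∷ʳ n) ⟨
    concatMap fareyRow (upTo n ++ [ n ])    ≡⟨ List.concatMap-++ fareyRow (upTo n) [ n ] ⟩
    fareyFractions n ++ (fareyRow n ++ [])  ≡⟨ cong (fareyFractions n ++_) (List.++-identityʳ _) ⟩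
    fareyFractions n ++ fareyRow n          ∎
  fareyRow-pos : ∀ n → All Positive (fareyRow n)
  -- The row is a suffix of the longer Farey list and inherits positivity from it.
  fareyRow-pos n = All.++⁻ʳ (fareyFractions n)
                     (subst (All Positive) (step n) (fareyFractions-pos (suc n)))

ord-F̄-2-7 : ord-F̄ 2 7 ≡ - 1ℤ
ord-F̄-2-7 = ord-F̄≡sum 2 7

-- Evaluation of finite integer sums.

sumTo-+ : ∀ f m n → sumTo f (m + n) ≡ sumTo f m ℤ.+ sumTo (λ i → f (m + i)) n
sumTo-+ f m zero    = trans (cong (sumTo f) (ℕ.+-identityʳ m)) (sym (ℤ.+-identityʳ (sumTo f m)))
sumTo-+ f m (suc n) = begin
  sumTo f (m + suc n)                                          ≡⟨ cong (sumTo f) (ℕ.+-suc m n) ⟩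
  sumTo f (m + n) ℤ.+ f (m + n)                                ≡⟨ cong (ℤ._+ f (m + n)) (sumTo-+ f m n) ⟩
  sumTo f m ℤ.+ sumTo (λ i → f (m + i)) n ℤ.+ f (m + n)        ≡⟨ ℤ.+-assoc (sumTo f m) _ _ ⟩
  sumTo f m ℤ.+ sumTo (λ i → f (m + i)) (suc n)                ∎
  where open ≡-Reasoning

ℤ-suc-* : ∀ n c → + suc n ℤ.* c ≡ + n ℤ.* c ℤ.+ c
ℤ-suc-* n c = trans (ℤ.suc-* (+ n) c) (ℤ.+-comm c (+ n ℤ.* c))

sumTo-const : ∀ f c n → (∀ {i} → i < n → f i ≡ c) → sumTo f n ≡ + n ℤ.* c
sumTo-const f c zero    h = sym (ℤ.*-zeroˡ c)
sumTo-const f c (suc n) h = trans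
  (cong₂ ℤ._+_ (sumTo-const f c n (h ∘ ℕ.m<n⇒m<1+n)) (h ℕ.≤-refl)) (sym (ℤ-suc-* n c))

sumTo-0 : ∀ f n → (∀ {i} → i < n → f i ≡ 0ℤ) → sumTo f n ≡ 0ℤ
sumTo-0 f n h = trans (sumTo-const f 0ℤ n h) (ℤ.*-zeroʳ (+ n))

sumTo-last : ∀ f n → (∀ {i} → i < n → f i ≡ 0ℤ) → sumTo f (suc n) ≡ f n
sumTo-last f n h = trans (cong (ℤ._+ f n) (sumTo-0 f n h)) (ℤ.+-identityˡ (f n))

-- Serves the sums whose terms alternate with the parity of the index: the row of 2p and the rows
-- beyond it.
sumTo-pairs : ∀ f c n → (∀ {i} → i < n → f (i * 2) ℤ.+ f (suc (i * 2)) ≡ c) →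
              sumTo f (n * 2) ≡ + n ℤ.* c
sumTo-pairs f c zero    h = sym (ℤ.*-zeroˡ c)
sumTo-pairs f c (suc n) h = begin
  sumTo f (n * 2) ℤ.+ f (n * 2) ℤ.+ f (suc (n * 2))
    ≡⟨ ℤ.+-assoc (sumTo f (n * 2)) _ _ ⟩
  sumTo f (n * 2) ℤ.+ (f (n * 2) ℤ.+ f (suc (n * 2)))
    ≡⟨ cong₂ ℤ._+_ (sumTo-pairs f c n (h ∘ ℕ.m<n⇒m<1+n)) (h ℕ.≤-refl) ⟩
  + n ℤ.* c ℤ.+ c
    ≡⟨ ℤ-suc-* n c ⟨
  + suc n ℤ.* c ∎
  where open ≡-Reasoning

-- Coprimality, parity and vanishing terms.

∤⇒coprime : ∀ {p} → Prime p → p ∤ n → Coprime p n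
∤⇒coprime pr p∤n (d∣p , d∣n) with prime⇒irreducible pr d∣p
... | inj₁ refl = refl
... | inj₂ refl = contradiction d∣n p∤n

coprime-* : Coprime m n → Coprime d n → Coprime (m * d) n
coprime-* m⊥n d⊥n (e∣md , e∣n) =
  -- A common divisor `e` of `m * d` and `n` is coprime to `m`, since a common divisor of `e` and
  -- `m` also divides `n`; hence `e` divides `d`.
  d⊥n (coprime-divisor (λ { (f∣e , f∣m) → m⊥n (f∣m , ∣-trans f∣e e∣n) }) e∣md , e∣n)

¬coprime : d ≢ 1 → d ∣ m → d ∣ n → gcd m n ≢ 1
¬coprime d≢1 d∣m d∣n eq = d≢1 (∣1⇒≡1 (subst (_ ∣_) eq (gcd-greatest d∣m d∣n)))

even : ∀ m → 2 ∣ m * 2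
even m = divides m refl

2∤1+ : 2 ∣ n → 2 ∤ suc n
2∤1+ {n} 2∣n 2∣1+n with ∣1⇒≡1 (∣m+n∣m⇒∣n {2} {n} {1} (subst (2 ∣_) (ℕ.+-comm 1 n) 2∣1+n) 2∣n)
... | ()

2∣2+ : 2 ∣ n → 2 ∣ suc (suc n)
2∣2+ = ∣m∣n⇒∣m+n ∣-refl

-- If the fraction is present, both exponents vanish; if it is absent, the term is zero anyway. So
-- only multiples of p among h and k can contribute.
term-∤ : ∀ {p} j i → p ∤ suc j → p ∤ suc i → term p j i ≡ 0ℤ
term-∤ {p} j i p∤k p∤h with gcd (suc i) (suc j) ℕ.≟ 1
... | no ¬c = term-¬coprime p j i ¬c
... | yes c = trans (term-coprime p j i c) (cong₂ (λ a b → + a ℤ.- + b) (ordℕ-∤ p∤k) (ordℕ-∤ p∤h))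

-- Rows with k < 2p, for any prime p.

module FirstRows {r} (pr : Prime (suc r)) where

  private
    p : ℕ
    p = suc r

  p∤small : ∀ {i} → i < r → p ∤ suc i
  p∤small i<r = >⇒∤ (s≤s i<r)

  -- Divisibility by p is unaffected by a shift by p; two applications reach the interval from 2p to
  -- 3p.
  p∤p+ : ∀ {i} → p ∤ suc i → p ∤ suc (p + i)
  p∤p+ {i} p∤i p∣ = p∤i (∣m+n∣m⇒∣n (subst (p ∣_) (sym (ℕ.+-suc p i)) p∣) ∣-refl)

  term-self : ∀ j → p ∤ suc j → term p j r ≡ - 1ℤ
  term-self j p∤k = trans (term-coprime p j r (coprime⇒gcd≡1 (∤⇒coprime pr p∤k)))
                          (cong₂ (λ a b → + a ℤ.- + b) (ordℕ-∤ p∤k) (ordℕ-self pr))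

  -- The index `r` stands for h = p, the only multiple of p among h ≤ p.
  firstBlock : ∀ j → p ∤ suc j → sumTo (term p j) p ≡ - 1ℤ
  firstBlock j p∤k = trans (sumTo-last (term p j) r (λ i<r → term-∤ j _ p∤k (p∤small i<r)))
                           (term-self j p∤k)

  row-below : ∀ {j} → j < r → row p j ≡ 0ℤ
  row-below {j} j<r = sumTo-0 (term p j) (suc j) λ i≤j →
    term-∤ j _ (p∤small j<r) (p∤small (ℕ.≤-<-trans (s≤s⁻¹ i≤j) j<r))

  p≢1 : p ≢ 1
  p≢1 refl = ¬prime[1] pr

  -- All of h = 1, ..., p - 1 are coprime to p and contribute 1 each; h = p is excluded by its gcd
  -- with k = p.
  row-p : row p r ≡ + r
  row-p = begin
    sumTo (term p r) r ℤ.+ term p r r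
      ≡⟨ cong₂ ℤ._+_ (sumTo-const (term p r) 1ℤ r one)
           (term-¬coprime p r r (¬coprime p≢1 ∣-refl ∣-refl)) ⟩
    + r ℤ.* 1ℤ ℤ.+ 0ℤ ≡⟨ ℤ.+-identityʳ _ ⟩
    + r ℤ.* 1ℤ        ≡⟨ ℤ.*-identityʳ (+ r) ⟩
    + r               ∎
    where
    open ≡-Reasoning
    one : ∀ {i} → i < r → term p r i ≡ 1ℤ
    one {i} i<r = trans
      (term-coprime p r i (coprime⇒gcd≡1 (Coprime.sym (prime⇒coprime pr (s≤s i<r)))))
      (cong₂ (λ a b → + a ℤ.- + b) (ordℕ-self pr) (ordℕ-∤ (p∤small i<r)))

  -- Here k = p + i + 1 lies strictly between p and 2p, so h = p is the only multiple of p.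
  row-p+ : ∀ {i} → i < r → row p (p + i) ≡ - 1ℤ
  row-p+ {i} i<r = begin
    sumTo f (suc (p + i))  ≡⟨ cong (sumTo f) (ℕ.+-suc p i) ⟨
    sumTo f (p + suc i)    ≡⟨ sumTo-+ f p (suc i) ⟩
    sumTo f p ℤ.+ sumTo (λ i′ → f (p + i′)) (suc i)
      ≡⟨ cong₂ ℤ._+_ (firstBlock (p + i) p∤k)
           (sumTo-0 _ (suc i) λ i′≤i →
              term-∤ (p + i) _ p∤k (p∤p+ (p∤small (ℕ.≤-<-trans (s≤s⁻¹ i′≤i) i<r)))) ⟩
    - 1ℤ ∎
    where
    open ≡-Reasoning
    f = term p (p + i)
    p∤k = p∤p+ (p∤small i<r)

  sum-p : sumTo (row p) p ≡ + r
  sum-p = trans (sumTo-last (row p) r row-below) row-p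

-- Rows with 2p ≤ k < 3p, for an odd prime p = 2q + 1.

module OddPrimeRows {q} (pr : Prime (suc (q * 2))) where

  open FirstRows pr

  private
    r p : ℕ
    r = q * 2
    p = suc r

    2∣r : 2 ∣ r
    2∣r = even q

    2p = suc (p + r)

    2p≡2*p : 2p ≡ 2 * p
    2p≡2*p = trans (sym (ℕ.+-suc p r)) (cong (_+_ p) (sym (ℕ.+-identityʳ p)))

    2∣2p : 2 ∣ 2p
    2∣2p = subst (2 ∣_) (sym 2p≡2*p) (m∣m*n p)

    p∣2p : p ∣ 2p
    p∣2p = divides 2 2p≡2*p

    p∤2 : p ∤ 2
    p∤2 p∣2 with irreducible[2] p∣2
    ... | inj₁ p≡1 = p≢1 p≡1
    ... | inj₂ p≡2 = 2∤1+ 2∣r (subst (2 ∣_) (sym p≡2) ∣-refl)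

    -- Oddness of p keeps the factor 2 from adding to the exponent.
    ordℕ-2p : ordℕ p 2p ≡ 1
    ordℕ-2p = trans (ordℕ-cong p 2p≡2*p)
              (trans (ordℕ-* p 2 p) (cong₂ _+_ (ordℕ-∤ p∤2) (ordℕ-self pr)))

    coprime-2p : ∀ {n} → 2 ∤ n → p ∤ n → Coprime 2p n
    coprime-2p {n} 2∤n p∤n = subst (λ x → Coprime x n) (sym 2p≡2*p)
      (coprime-* (∤⇒coprime prime[2] 2∤n) (∤⇒coprime pr p∤n))

    term-2p-even : ∀ i → 2 ∣ suc i → term p (p + r) i ≡ 0ℤ
    term-2p-even i 2∣h = term-¬coprime p (p + r) i (¬coprime (λ ()) 2∣h 2∣2p)

    term-2p-p∣ : ∀ i → p ∣ suc i → term p (p + r) i ≡ 0ℤ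
    term-2p-p∣ i p∣h = term-¬coprime p (p + r) i (¬coprime p≢1 p∣h p∣2p)

    term-2p-odd : ∀ i → 2 ∤ suc i → p ∤ suc i → term p (p + r) i ≡ 1ℤ
    term-2p-odd i 2∤h p∤h = trans
      (term-coprime p (p + r) i (coprime⇒gcd≡1 (Coprime.sym (coprime-2p 2∤h p∤h))))
      (cong₂ (λ a b → + a ℤ.- + b) ordℕ-2p (ordℕ-∤ p∤h))

    2i<r : ∀ {i} → i < q → i * 2 < r
    2i<r = ℕ.*-monoˡ-< 2

    1+2i<r : ∀ {i} → i < q → suc (i * 2) < r
    1+2i<r {i} i<q = ℕ.*-monoˡ-≤ 2 i<q

    2∤1+2i : ∀ i → 2 ∤ suc (i * 2)
    2∤1+2i i = 2∤1+ (even i)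

    2∣p+1+2i : ∀ i → 2 ∣ suc (p + i * 2)
    2∣p+1+2i i = 2∣2+ (∣m∣n⇒∣m+n 2∣r (even i))

    2∤p+2+2i : ∀ i → 2 ∤ suc (p + suc (i * 2))
    2∤p+2+2i i = subst (2 ∤_) (cong suc (sym (ℕ.+-suc p (i * 2)))) (2∤1+ (2∣p+1+2i i))

    2∤2p+1+2i : ∀ i → 2 ∤ suc (p + (p + i * 2))
    2∤2p+1+2i i = subst (λ x → 2 ∤ suc (suc x)) (sym (ℕ.+-suc r (r + i * 2)))
                   (2∤1+ (2∣2+ (∣m∣n⇒∣m+n 2∣r (∣m∣n⇒∣m+n 2∣r (even i)))))

    2∣2p+2+2i : ∀ i → 2 ∣ suc (p + (p + suc (i * 2)))
    2∣2p+2+2i i = subst (2 ∣_) (lemma r (i * 2))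
      (2∣2+ (2∣2+ (∣m∣n⇒∣m+n 2∣r (∣m∣n⇒∣m+n 2∣r (even i)))))
      where
      lemma : ∀ a b → suc (suc (suc (suc (a + (a + b))))) ≡ suc (suc a + (suc a + suc b))
      lemma = ℕ.solve-∀

    q+q : + q ℤ.* 1ℤ ℤ.+ 0ℤ ℤ.+ (+ q ℤ.* 1ℤ ℤ.+ 0ℤ) ≡ + r
    q+q = trans (lemma (+ q)) (sym (ℤ.pos-* q 2))
      where
      lemma : ∀ x → x ℤ.* 1ℤ ℤ.+ 0ℤ ℤ.+ (x ℤ.* 1ℤ ℤ.+ 0ℤ) ≡ x ℤ.* + 2
      lemma = solve-∀

  -- Only odd h other than p count, each with 1. In each block of p values of h the last one, p or
  -- 2p, drops out and the rest form q pairs, giving 2q = p - 1 in all. The odd member comes first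
  -- in the pairs below p and second in those beyond p.
  row-2p : row p (p + r) ≡ + r
  row-2p = begin
    sumTo f (suc (p + r))  ≡⟨ cong (sumTo f) (ℕ.+-suc p r) ⟨
    sumTo f (p + p)        ≡⟨ sumTo-+ f p p ⟩
    sumTo f r ℤ.+ f r ℤ.+ (sumTo (λ i → f (p + i)) r ℤ.+ f (p + r))
      ≡⟨ cong₂ ℤ._+_
           (cong₂ ℤ._+_ (sumTo-pairs f 1ℤ q pair₁) (term-2p-p∣ r ∣-refl))
           (cong₂ ℤ._+_ (sumTo-pairs (λ i → f (p + i)) 1ℤ q pair₂) (term-2p-p∣ (p + r) p∣2p)) ⟩
    + q ℤ.* 1ℤ ℤ.+ 0ℤ ℤ.+ (+ q ℤ.* 1ℤ ℤ.+ 0ℤ) ≡⟨ q+q ⟩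
    + r ∎
    where
    open ≡-Reasoning
    f = term p (p + r)
    pair₁ : ∀ {i} → i < q → f (i * 2) ℤ.+ f (suc (i * 2)) ≡ 1ℤ
    pair₁ {i} i<q = cong₂ ℤ._+_ (term-2p-odd (i * 2) (2∤1+2i i) (p∤small (2i<r i<q)))
      (term-2p-even (suc (i * 2)) (even (suc i)))
    pair₂ : ∀ {i} → i < q → f (p + i * 2) ℤ.+ f (p + suc (i * 2)) ≡ 1ℤ
    pair₂ {i} i<q = cong₂ ℤ._+_ (term-2p-even (p + i * 2) (2∣p+1+2i i))
      (term-2p-odd (p + suc (i * 2)) (2∤p+2+2i i) (p∤p+ (p∤small (1+2i<r i<q))))

  -- The values of h split at p and 2p. As k < 3p, the only multiples of p are h = p, contributing
  -- -1, and h = 2p, whose term is left open because it depends on the parity of k.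
  row-2p+ : ∀ {i} → i < r → row p (p + (p + i)) ≡ - 1ℤ ℤ.+ term p (p + (p + i)) (p + r)
  row-2p+ {i} i<r = begin
    sumTo f (suc (p + (p + i)))
      ≡⟨ cong (sumTo f) (lemma p i) ⟩
    sumTo f (p + (p + suc i))
      ≡⟨ sumTo-+ f p (p + suc i) ⟩
    sumTo f p ℤ.+ sumTo f₁ (p + suc i)
      ≡⟨ cong₂ ℤ._+_ (firstBlock (p + (p + i)) p∤k) (sumTo-+ f₁ p (suc i)) ⟩
    - 1ℤ ℤ.+ (sumTo f₁ p ℤ.+ sumTo f₂ (suc i))
      ≡⟨ cong (λ x → - 1ℤ ℤ.+ x) (cong₂ ℤ._+_
           (sumTo-last f₁ r λ i′<r → f-∤ (p∤p+ (p∤small i′<r)))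
           (sumTo-0 f₂ (suc i) λ i′≤i →
              f-∤ (p∤p+ (p∤p+ (p∤small (ℕ.≤-<-trans (s≤s⁻¹ i′≤i) i<r)))))) ⟩
    - 1ℤ ℤ.+ (f (p + r) ℤ.+ 0ℤ)
      ≡⟨ cong (λ x → - 1ℤ ℤ.+ x) (ℤ.+-identityʳ (f (p + r))) ⟩
    - 1ℤ ℤ.+ f (p + r) ∎
    where
    open ≡-Reasoning
    f f₁ f₂ : ℕ → ℤ
    f  = term p (p + (p + i))
    f₁ = λ i′ → f (p + i′)
    f₂ = λ i′ → f (p + (p + i′))
    p∤k = p∤p+ (p∤p+ (p∤small i<r))
    f-∤ : ∀ {i′} → p ∤ suc i′ → f i′ ≡ 0ℤ
    f-∤ = term-∤ (p + (p + i)) _ p∤k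
    lemma : ∀ a b → suc (a + (a + b)) ≡ a + (a + suc b)
    lemma = ℕ.solve-∀

  -- The index is k - 1, so k = 2p + 2i + 1 is odd and coprime to 2p.
  row-oddAbove2p : ∀ {i} → i < q → row p (p + (p + i * 2)) ≡ - + 2
  row-oddAbove2p {i} i<q = trans (row-2p+ (2i<r i<q)) (cong (λ x → - 1ℤ ℤ.+ x) (trans
    (term-coprime p (p + (p + i * 2)) (p + r) (coprime⇒gcd≡1 (coprime-2p (2∤2p+1+2i i) p∤k)))
    (cong₂ (λ a b → + a ℤ.- + b) (ordℕ-∤ p∤k) ordℕ-2p)))
    where p∤k = p∤p+ (p∤p+ (p∤small (2i<r i<q)))

  -- Here k = 2p + 2i + 2 shares the factor 2 with h = 2p, whose term therefore vanishes.
  row-evenAbove2p : ∀ {i} → i < q → row p (p + (p + suc (i * 2))) ≡ - 1ℤ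
  row-evenAbove2p {i} i<q = trans (row-2p+ (1+2i<r i<q)) (cong (λ x → - 1ℤ ℤ.+ x)
    (term-¬coprime p (p + (p + suc (i * 2))) (p + r) (¬coprime (λ ()) 2∣2p (2∣2p+2+2i i))))

  -- The p - 1 rows strictly between p and 2p contribute -1 each and cancel the row of 2p, so only
  -- the p - 1 from the row of p remains.
  sum-2p+ : ∀ m → sumTo (row p) (p + (p + m)) ≡ + r ℤ.+ sumTo (λ i → row p (p + (p + i))) m
  sum-2p+ m = begin
    sumTo (row p) (p + (p + m))
      ≡⟨ sumTo-+ (row p) p (p + m) ⟩
    sumTo (row p) p ℤ.+ sumTo (λ i → row p (p + i)) (p + m)
      ≡⟨ cong₂ ℤ._+_ sum-p (sumTo-+ (λ i → row p (p + i)) p m) ⟩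
    + r ℤ.+ (sumTo (λ i → row p (p + i)) r ℤ.+ row p (p + r) ℤ.+ S)
      ≡⟨ cong (λ x → + r ℤ.+ (x ℤ.+ S)) (cong₂ ℤ._+_
           (sumTo-const (λ i → row p (p + i)) (- 1ℤ) r row-p+) row-2p) ⟩
    + r ℤ.+ (+ r ℤ.* (- 1ℤ) ℤ.+ + r ℤ.+ S)
      ≡⟨ lemma (+ r) S ⟩
    + r ℤ.+ S ∎
    where
    open ≡-Reasoning
    S = sumTo (λ i → row p (p + (p + i))) m
    lemma : ∀ x y → x ℤ.+ (x ℤ.* (- 1ℤ) ℤ.+ x ℤ.+ y) ≡ x ℤ.+ y
    lemma = solve-∀

  -- Each pair of rows beyond 2p contributes -3. The bound `t ≤ q` keeps all rows below 3p, and
  -- `t = q` is the case n = 3p - 1.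
  ord-F̄-evenOffset : ∀ {t} → t ≤ q → ord-F̄ p (p + (p + t * 2)) ≡ r ⊖ t * 3
  ord-F̄-evenOffset {t} t≤q = begin
    ord-F̄ p (p + (p + t * 2))
      ≡⟨ ord-F̄≡sum p (p + (p + t * 2)) ⟩
    sumTo (row p) (p + (p + t * 2))
      ≡⟨ sum-2p+ (t * 2) ⟩
    + r ℤ.+ sumTo g (t * 2)
      ≡⟨ cong (ℤ._+_ (+ r)) (sumTo-pairs g (- + 3) t λ i<t →
           cong₂ ℤ._+_ (row-oddAbove2p (ℕ.<-≤-trans i<t t≤q))
                       (row-evenAbove2p (ℕ.<-≤-trans i<t t≤q))) ⟩
    + r ℤ.+ + t ℤ.* (- + 3)
      ≡⟨ cong (ℤ._+_ (+ r)) (ℤ.neg-distribʳ-* (+ t) (+ 3)) ⟨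
    + r ℤ.- + t ℤ.* + 3
      ≡⟨ cong (ℤ._-_ (+ r)) (ℤ.pos-* t 3) ⟨
    + r ℤ.- + (t * 3)
      ≡⟨ ℤ.m-n≡m⊖n r (t * 3) ⟩
    r ⊖ t * 3 ∎
    where
    open ≡-Reasoning
    g = λ i → row p (p + (p + i))

  -- One further row, with k odd, takes 2 from the even case.
  ord-F̄-oddOffset : ∀ {t} → t < q → ord-F̄ p (p + (p + suc (t * 2))) ≡ r ⊖ (2 + t * 3)
  ord-F̄-oddOffset {t} t<q = begin
    ord-F̄ p (p + (p + suc (t * 2)))
      ≡⟨ ord-F̄≡sum p (p + (p + suc (t * 2))) ⟩
    sumTo (row p) (p + (p + suc (t * 2)))
      ≡⟨ sum-2p+ (suc (t * 2)) ⟩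
    + r ℤ.+ (sumTo g (t * 2) ℤ.+ g (t * 2))
      ≡⟨ ℤ.+-assoc (+ r) (sumTo g (t * 2)) (g (t * 2)) ⟨
    + r ℤ.+ sumTo g (t * 2) ℤ.+ g (t * 2)
      ≡⟨ cong (ℤ._+ g (t * 2)) (sum-2p+ (t * 2)) ⟨
    sumTo (row p) (p + (p + t * 2)) ℤ.+ g (t * 2)
      ≡⟨ cong (ℤ._+ g (t * 2)) (ord-F̄≡sum p (p + (p + t * 2))) ⟨
    ord-F̄ p (p + (p + t * 2)) ℤ.+ g (t * 2)
      ≡⟨ cong₂ ℤ._+_ (ord-F̄-evenOffset (ℕ.<⇒≤ t<q)) (row-oddAbove2p t<q) ⟩
    (r ⊖ t * 3) ℤ.- + 2
      ≡⟨ ℤ.+-comm (r ⊖ t * 3) (- + 2) ⟩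
    - + 2 ℤ.+ (r ⊖ t * 3)
      -- The argument 1 encodes -2 as `-[1+ 1 ]`.
      ≡⟨ ℤ.distribʳ-⊖-+-neg 1 r (t * 3) ⟩
    r ⊖ (2 + t * 3) ∎
    where
    open ≡-Reasoning
    g = λ i → row p (p + (p + i))

-- Parity and inequalities.

parity : ∀ n → (∃[ t ] n ≡ t * 2) ⊎ (∃[ t ] n ≡ suc (t * 2))
parity zero = inj₁ (0 , refl)
parity (suc n) with parity n
... | inj₁ (t , n≡2t)   = inj₂ (t , cong suc n≡2t)
... | inj₂ (t , n≡1+2t) = inj₁ (suc t , cong suc n≡1+2t)

-- On unnormalised rationals the order is cross-multiplication, which clears the denominator 3
-- without reducing any fraction.
8/3-bound : ∀ p n → (+ 8 ℚ./ 3) ℚ.* (+ p ℚ./ 1) ℚ.≤ (+ n ℚ./ 1) → 8 * p ≤ 3 * n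
8/3-bound p n le with bound
  where
  open ℚᵘ.≤-Reasoning
  bound : mkℚᵘ (+ 8) 2 ℚᵘ.* mkℚᵘ (+ p) 0 ℚᵘ.≤ mkℚᵘ (+ n) 0
  bound = begin
    mkℚᵘ (+ 8) 2 ℚᵘ.* mkℚᵘ (+ p) 0
      ≃⟨ ℚᵘ.*-congˡ {mkℚᵘ (+ 8) 2} (ℚ.toℚᵘ-fromℚᵘ (mkℚᵘ (+ p) 0)) ⟨
    ℚ.toℚᵘ (+ 8 ℚ./ 3) ℚᵘ.* ℚ.toℚᵘ (+ p ℚ./ 1)
      ≃⟨ ℚ.toℚᵘ-homo-* (+ 8 ℚ./ 3) (+ p ℚ./ 1) ⟨
    ℚ.toℚᵘ ((+ 8 ℚ./ 3) ℚ.* (+ p ℚ./ 1))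
      ≤⟨ ℚ.toℚᵘ-mono-≤ le ⟩
    ℚ.toℚᵘ (+ n ℚ./ 1)
      ≃⟨ ℚ.toℚᵘ-fromℚᵘ (mkℚᵘ (+ n) 0) ⟩
    mkℚᵘ (+ n) 0 ∎
... | *≤* le′ = ℤ.drop‿+≤+ (subst₂ ℤ._≤_ lhs rhs le′)
  where
  lhs : + 8 ℤ.* + p ℤ.* 1ℤ ≡ + (8 * p)
  lhs = trans (ℤ.*-identityʳ (+ 8 ℤ.* + p)) (sym (ℤ.pos-* 8 p))
  rhs : + n ℤ.* + 3 ≡ + (3 * n)
  rhs = trans (sym (ℤ.pos-* n 3)) (cong (λ x → + x) (ℕ.*-comm n 3))

⊖-negative : ∀ m n → m < n → m ⊖ n ℤ.< 0ℤ
⊖-negative m n m<n = subst (λ x → m ⊖ n ℤ.< x) (ℤ.n⊖n≡0 m) (ℤ.⊖-monoʳ->-< m m<n)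

-- Values at p and 3p - 1, and negativity from 8p/3 to 3p - 1.

ord-F̄-p : ∀ p → Prime p → ord-F̄ p p ≡ + p ℤ.- 1ℤ × 0ℤ ℤ.< + p ℤ.- 1ℤ
ord-F̄-p zero          pr = contradiction pr ¬prime[0]
ord-F̄-p (suc zero)    pr = contradiction pr ¬prime[1]
ord-F̄-p (suc (suc r)) pr = trans (ord-F̄≡sum (2 + r) (2 + r)) (FirstRows.sum-p pr) , ℤ.+<+ z<s

module _ q (pr : Prime (suc (q * 2))) where

  private
    r p : ℕ
    r = q * 2
    p = suc r

  open OddPrimeRows {q} pr

  3p∸1 : 3 * p ∸ 1 ≡ p + (p + r)
  3p∸1 = lemma r
    where
    lemma : ∀ r → r + (suc r + (suc r + 0)) ≡ suc r + (suc r + r)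
    lemma = ℕ.solve-∀

  -- This is the even offset with `t = q`: 2q - 3q = -q, and q = (p - 1) / 2.
  ord-F̄-3p∸1 : ord-F̄ p (3 * p ∸ 1) ≡ - + ((p ∸ 1) / 2)
  ord-F̄-3p∸1 = begin
    ord-F̄ p (3 * p ∸ 1)          ≡⟨ cong (ord-F̄ p) 3p∸1 ⟩
    ord-F̄ p (p + (p + r))        ≡⟨ ord-F̄-evenOffset ℕ.≤-refl ⟩
    q * 2 ⊖ q * 3                ≡⟨ ℤ.m-n≡m⊖n (q * 2) (q * 3) ⟨
    + (q * 2) ℤ.- + (q * 3)      ≡⟨ cong₂ ℤ._-_ (ℤ.pos-* q 2) (ℤ.pos-* q 3) ⟩
    + q ℤ.* + 2 ℤ.- + q ℤ.* + 3  ≡⟨ lemma (+ q) ⟩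
    - + q                        ≡⟨ cong (λ x → - + x) (m*n/n≡m q 2) ⟨
    - + (q * 2 / 2)              ∎
    where
    open ≡-Reasoning
    lemma : ∀ x → x ℤ.* + 2 ℤ.- x ℤ.* + 3 ≡ - x
    lemma = solve-∀

  -- Subtracting 6p turns the bound into 2p ≤ 3m. This gives p ≤ 3t for m = 2t and p ≤ 3t + 2 for m
  -- = 2t + 1, while the order is p - 1 minus 3t or 3t + 2 respectively.
  ord-F̄-2p+<0 : ∀ m → 8 * p ≤ 3 * (p + (p + m)) → m ≤ r → ord-F̄ p (p + (p + m)) ℤ.< 0ℤ
  ord-F̄-2p+<0 m 8p≤3n m≤r = by-parity (parity m)
    where
    open ℕ.≤-Reasoning
    2p≤3m : 2 * p ≤ 3 * m
    2p≤3m = ℕ.+-cancelˡ-≤ (6 * p) (2 * p) (3 * m) (subst₂ _≤_ (lhs p) (rhs p m) 8p≤3n)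
      where
      lhs : ∀ p → 8 * p ≡ 6 * p + 2 * p
      lhs = ℕ.solve-∀
      rhs : ∀ p m → 3 * (p + (p + m)) ≡ 6 * p + 3 * m
      rhs = ℕ.solve-∀
    by-parity : (∃[ t ] m ≡ t * 2) ⊎ (∃[ t ] m ≡ suc (t * 2)) → ord-F̄ p (p + (p + m)) ℤ.< 0ℤ
    by-parity (inj₁ (t , refl)) = subst (ℤ._< 0ℤ) (sym (ord-F̄-evenOffset (ℕ.*-cancelʳ-≤ t q 2 m≤r)))
      (⊖-negative r (t * 3) (ℕ.*-cancelˡ-≤ {p} {t * 3} 2 (subst (2 * p ≤_) (lemma t) 2p≤3m)))
      where
      lemma : ∀ t → 3 * (t * 2) ≡ 2 * (t * 3)
      lemma = ℕ.solve-∀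
    -- Here `m≤r` is definitionally `t * 2 < q * 2`, which gives the strict bound on `t`.
    by-parity (inj₂ (t , refl)) = subst (ℤ._< 0ℤ) (sym (ord-F̄-oddOffset (ℕ.*-cancelʳ-< 2 t q m≤r)))
      (⊖-negative r (2 + t * 3) (ℕ.*-cancelˡ-≤ {p} {2 + t * 3} 2 (begin
        2 * p                   ≤⟨ 2p≤3m ⟩
        -- Passing from 6t + 3 to 6t + 4 makes the right side even, so that 2 can be cancelled.
        3 * suc (t * 2)         ≤⟨ ℕ.n≤1+n (3 * suc (t * 2)) ⟩
        suc (3 * suc (t * 2))   ≡⟨ lemma t ⟩
        2 * (2 + t * 3)         ∎)))
      where
      lemma : ∀ t → suc (3 * suc (t * 2)) ≡ 2 * (2 + t * 3)
      lemma = ℕ.solve-∀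

  -- From 8p ≤ 3n follows 2p ≤ n, so n is 2p plus an offset `k`, which n ≤ 3p - 1 bounds by `r`.
  ord-F̄<0 : ∀ n → 8 * p ≤ 3 * n → n ≤ 3 * p ∸ 1 → ord-F̄ p n ℤ.< 0ℤ
  ord-F̄<0 n 8p≤3n n≤3p∸1 = subst (λ x → ord-F̄ p x ℤ.< 0ℤ) (sym n≡) (ord-F̄-2p+<0 k
    (subst (λ x → 8 * p ≤ 3 * x) n≡ 8p≤3n)
    (ℕ.+-cancelˡ-≤ p k r (ℕ.+-cancelˡ-≤ p (p + k) (p + r) (subst₂ _≤_ n≡ 3p∸1 n≤3p∸1))))
    where
    k = n ∸ (p + p)
    open ℕ.≤-Reasoning
    p+p≤n : p + p ≤ n
    p+p≤n = ℕ.*-cancelˡ-≤ 3 (begin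
      3 * (p + p)  ≡⟨ lemma p ⟩
      6 * p        ≤⟨ ℕ.*-monoˡ-≤ p (ℕ.m≤n+m 6 2) ⟩
      8 * p        ≤⟨ 8p≤3n ⟩
      3 * n        ∎)
      where
      lemma : ∀ p → 3 * (p + p) ≡ 6 * p
      lemma = ℕ.solve-∀
    n≡ : n ≡ p + (p + k)
    n≡ = trans (sym (ℕ.m+[n∸m]≡n p+p≤n)) (ℕ.+-assoc p p k)

-- The parity of p is an argument here and below because a with-abstraction over it would make
-- Agda normalise ord-F̄ in the goal.
ord-F̄-odd : ∀ p → Prime p → (∃[ t ] p ≡ t * 2) ⊎ (∃[ t ] p ≡ suc (t * 2)) → ¬ (2 ∣ p) →
  ord-F̄ p (3 * p ∸ 1) ≡ - (+ ((p ∸ 1) / 2))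
  × (∀ n → (+ 8 ℚ./ 3) ℚ.* (+ p ℚ./ 1) ℚ.≤ (+ n ℚ./ 1) → n ≤ 3 * p ∸ 1 → ord-F̄ p n ℤ.< 0ℤ)
ord-F̄-odd p pr (inj₁ (t , p≡2t)) 2∤p = contradiction (divides t p≡2t) 2∤p
ord-F̄-odd _ pr (inj₂ (q , refl)) _   =
  ord-F̄-3p∸1 q pr , λ n le → ord-F̄<0 q pr n (8/3-bound (suc (q * 2)) n le)

ord-F̄-negative : ∀ p → Prime p → (∃[ t ] p ≡ t * 2) ⊎ (∃[ t ] p ≡ suc (t * 2)) →
                 ∃[ n ] (1 ≤ n × ord-F̄ p n ℤ.< 0ℤ)
ord-F̄-negative p pr (inj₁ (t , p≡2t)) =
  -- An even prime is 2, for which n = 7 is the witness.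
  7 , z<s , subst (λ x → ord-F̄ x 7 ℤ.< 0ℤ) 2≡p (subst (ℤ._< 0ℤ) (sym ord-F̄-2-7) ℤ.-<+)
  where
  2≡p : 2 ≡ p
  2≡p with prime⇒irreducible pr (divides t p≡2t)
  ... | inj₂ eq = eq
ord-F̄-negative _ pr (inj₂ (zero  , refl)) = contradiction pr ¬prime[1]
-- The witness is n = 3p - 1. As `suc q` is positive, its double minus its triple is negative.
ord-F̄-negative _ pr (inj₂ (suc q , refl)) = p + (p + suc q * 2) , z<s ,
  subst (ℤ._< 0ℤ) (sym (OddPrimeRows.ord-F̄-evenOffset {suc q} pr ℕ.≤-refl))
    (⊖-negative (suc q * 2) (suc q * 3) (ℕ.*-monoʳ-< (suc q) {2} {3} ℕ.≤-refl))
  where p = suc (suc q * 2)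

ord-F̄-positive : ∀ p → Prime p → ∃[ n ] (1 ≤ n × 0ℤ ℤ.< ord-F̄ p n)
ord-F̄-positive p@(suc _) pr =
  p , z<s , subst (0ℤ ℤ.<_) (sym (proj₁ (ord-F̄-p p pr))) (proj₂ (ord-F̄-p p pr))
ord-F̄-positive zero      pr = contradiction pr ¬prime[0]

theorem4p10 : (∀ p → Prime p →
    (∃[ n ] (1 ≤ n × 0ℤ ℤ.< ord-F̄ p n)) × (∃[ n ] (1 ≤ n × ord-F̄ p n ℤ.< 0ℤ)))
    × (∀ p → Prime p → ord-F̄ p p ≡ + p ℤ.- 1ℤ × 0ℤ ℤ.< + p ℤ.- 1ℤ)
    × ord-F̄ 2 7 ≡ - 1ℤ
    × (∀ p → Prime p → ¬ (2 ∣ p) →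
    ord-F̄ p (3 * p ∸ 1) ≡ - (+ ((p ∸ 1) / 2))
    × (∀ n → (+ 8 ℚ./ 3) ℚ.* (+ p ℚ./ 1) ℚ.≤ (+ n ℚ./ 1) → n ≤ 3 * p ∸ 1 →
    ord-F̄ p n ℤ.< 0ℤ))
theorem4p10 =
  (λ p pr → ord-F̄-positive p pr , ord-F̄-negative p pr (parity p))
  , ord-F̄-p
  , ord-F̄-2-7
  , λ p pr → ord-F̄-odd p pr (parity p)
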